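{- For all integers $k\geq1$, \[ (1-tq)\, T_k(tq,q) = T_k(t,q) + t^2 q^{2k+1}\, T_{k-1}(t,q). \]
   Context: The polynomials $T_k(t,q)$ in the indeterminates $t,q$ are defined by $T_0(t,q)=1$ and, for $k\ge1$, \[ T_k(t,q) = T_{k-1}(t,q) + (1+t)(-q)^{k^2} + (1-t^2) \sum_{i=1}^{k-1} (-q)^{k^2-i^2}\, T_{i-1}(t,q). \] $T_k(tq,q)$ denotes the result of substituting $tq$ for $t$. -}

module Defs where

open import Algebra.Bundles.Raw using (RawRing)
open import Data.Integer.Base using (+-*-rawRing)
open import Data.List.Base using (List; []; _∷_; map)
open import Data.Nat.Base as ℕ using (ℕ; zero; suc; _∸_)
open import Level using (0ℓ)

-- Univariate polynomials over R as coefficient lists, constant term first.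
-- Trailing zeros are allowed, and equality is equality of all coefficients.
module Polynomial {c ℓ} (R : RawRing c ℓ) where

  private module R = RawRing R

  Poly : Set c
  Poly = List R.Carrier

  coeff : Poly → ℕ → R.Carrier
  coeff []      _       = R.0#
  coeff (a ∷ _) zero    = a
  coeff (_ ∷ p) (suc n) = coeff p n

  _≈ₚ_ : Poly → Poly → Set ℓ
  p ≈ₚ r = ∀ n → coeff p n R.≈ coeff r n

  _+ₚ_ : Poly → Poly → Poly
  []      +ₚ r       = r
  (a ∷ p) +ₚ []      = a ∷ p
  (a ∷ p) +ₚ (b ∷ r) = (a R.+ b) ∷ (p +ₚ r)

  -- (a + X p) r = a r + X (p r)
  _*ₚ_ : Poly → Poly → Poly
  []      *ₚ r = []
  (a ∷ p) *ₚ r = map (a R.*_) r +ₚ (R.0# ∷ (p *ₚ r))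

  const : R.Carrier → Poly
  const a = a ∷ []

  X : Poly
  X = R.0# ∷ R.1# ∷ []

  -- p ⟨ r ⟩ is the result of substituting r for X in p (by Horner's rule).
  _⟨_⟩ : Poly → Poly → Poly
  []      ⟨ r ⟩ = []
  (a ∷ p) ⟨ r ⟩ = const a +ₚ (r *ₚ (p ⟨ r ⟩))

  rawRing : RawRing c ℓ
  rawRing = record
    { Carrier = Poly
    ; _≈_     = _≈ₚ_
    ; _+_     = _+ₚ_
    ; _*_     = _*ₚ_
    ; -_      = map (R.-_)
    ; 0#      = []
    ; 1#      = const R.1#
    }

ℤ[q] : RawRing 0ℓ 0ℓ
ℤ[q] = Polynomial.rawRing +-*-rawRing

-- ℤ[t,q] is (ℤ[q])[t]: the outer variable is t, and q is a constant of it.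
ℤ[t,q] : RawRing 0ℓ 0ℓ
ℤ[t,q] = Polynomial.rawRing ℤ[q]

open RawRing ℤ[t,q] public using (Carrier; _≈_; _+_; _*_; -_; 1#; 0#)
open import Algebra.Definitions.RawSemiring (RawRing.rawSemiring ℤ[t,q]) public
  using (_^_)

infixl 6 _-_
_-_ : Carrier → Carrier → Carrier
x - y = x + (- y)

t q : Carrier
t = Polynomial.X ℤ[q]
q = Polynomial.const ℤ[q] (Polynomial.X +-*-rawRing)

-- Substitution for t, leaving q fixed.
infix 9 _[t:=_]
_[t:=_] : Carrier → Carrier → Carrier
_[t:=_] = Polynomial._⟨_⟩ ℤ[q]

-- S k m is the sum of (-q)^(k² - i²) T_{i-1} over 1 ≤ i ≤ m. It is only used
-- with m < k, so the truncated subtraction in the exponent is exact.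
T : ℕ → Carrier
S : ℕ → ℕ → Carrier

T zero    = 1#
T (suc n) = T n + (1# + t) * (- q) ^ (suc n ℕ.^ 2)
                + (1# - t ^ 2) * S (suc n) n

S k zero    = 0#
S k (suc m) = S k m + (- q) ^ (k ℕ.^ 2 ∸ suc m ℕ.^ 2) * T m

{-# OPTIONS --safe #-}

-- Put Q = -q, u = -t² and cₙ = Q^(2n+1). Since (n+2)² - i² = (2n+3) + (n+1)² - i²,
-- the defining sum telescopes into the three-term recurrence
--   T_{n+2} = (1 + c_{n+1}) T_{n+1} + u c_{n+1} T_n.
-- The substitution t ↦ tq is a ring endomorphism fixing Q and sending u to uQ²,
-- so (1 - tq) T_k(tq,q) satisfies that recurrence with uQ² in place of u. A short
-- computation shows that T_k + u c_k T_{k-1} satisfies it too, and the two sequences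
-- agree for k = 1 and k = 2.

module Submission where

open import Algebra.Bundles using (AbelianGroup; CommutativeRing)
open import Algebra.Bundles.Raw using (RawRing)
import Algebra.Consequences.Setoid as Consequences
import Algebra.Construct.Pointwise as Pointwise
import Algebra.Morphism.GroupMonomorphism as GroupMonomorphism
import Algebra.Morphism.RingMonomorphism as RingMonomorphism
open import Algebra.Morphism.Structures
  using (IsGroupMonomorphism; IsRingMonomorphism; IsRingHomomorphism)
import Algebra.Properties.CommutativeSemigroup as CommutativeSemigroupProperties
import Algebra.Properties.Group as GroupProperties
import Algebra.Properties.Ring as RingProperties
import Algebra.Properties.Semiring.Exp as Exp
import Algebra.Solver.Ring.NaturalCoefficients.Default as SemiringSolver
open import Algebra.Structures using (IsAbelianGroup; IsCommutativeRing)
open import Data.Integer.Base using (+-*-rawRing)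
open import Data.Integer.Properties using (+-*-commutativeRing)
open import Data.List.Base using ([]; _∷_; map)
open import Data.Nat.Base as ℕ using (ℕ; zero; suc; _≥_; _∸_; _≤_)
import Data.Nat.Properties as ℕ
open import Data.Nat.Tactic.RingSolver using (solve-∀)
open import Data.Product.Base using (_,_)
import Relation.Binary.PropositionalEquality as ≡
import Relation.Binary.Reasoning.Setoid as ≈-Reasoning

open import Defs using (module Polynomial)

-- Polynomials over a commutative ring.

module PolynomialRing {c ℓ} (R : CommutativeRing c ℓ) where

  private module R = CommutativeRing R
  open Polynomial R.rawRing renaming
    ( rawRing to polyRawRing; _+ₚ_ to infixl 6 _+ₚ_; _*ₚ_ to infixl 7 _*ₚ_
    ; _⟨_⟩ to infix 9 _⟨_⟩; _≈ₚ_ to infix 4 _≈ₚ_ )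

  -- _≈ₚ_ unfolds to a Π-type, from which Agda cannot recover the two polynomials;
  -- the record keeps them visible to unification.
  record _≋_ (p r : Poly) : Set ℓ where
    constructor coefficientwise
    field coeff-≈ : p ≈ₚ r
  open _≋_

  infix 4 _≋_

  infix 8 -ₚ_
  -ₚ_ : Poly → Poly
  -ₚ_ = RawRing.-_ polyRawRing

  scale : R.Carrier → Poly → Poly
  scale a = map (a R.*_)

  shift : Poly → Poly
  shift p = R.0# ∷ p

  -- The additive group.

  coeff-+ : ∀ p r n → coeff (p +ₚ r) n R.≈ coeff p n R.+ coeff r n
  coeff-+ []      r       n       = R.sym (R.+-identityˡ _)
  coeff-+ (a ∷ p) []      n       = R.sym (R.+-identityʳ _)
  coeff-+ (a ∷ p) (b ∷ r) zero    = R.refl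
  coeff-+ (a ∷ p) (b ∷ r) (suc n) = coeff-+ p r n

  coeff-neg : ∀ p n → coeff (-ₚ p) n R.≈ R.- coeff p n
  coeff-neg []      n       = R.sym (GroupProperties.ε⁻¹≈ε R.+-group)
  coeff-neg (a ∷ p) zero    = R.refl
  coeff-neg (a ∷ p) (suc n) = coeff-neg p n

  coeff-scale : ∀ a p n → coeff (scale a p) n R.≈ a R.* coeff p n
  coeff-scale a []      n       = R.sym (R.zeroʳ a)
  coeff-scale a (b ∷ p) zero    = R.refl
  coeff-scale a (b ∷ p) (suc n) = coeff-scale a p n

  ≋-rawRing : RawRing c ℓ
  ≋-rawRing = record
    { _≈_ = _≋_ ; _+_ = _+ₚ_ ; _*_ = _*ₚ_ ; -_ = -ₚ_ ; 0# = [] ; 1# = const R.1# }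

  -- `coeff` embeds polynomials into the functions on ℕ with pointwise addition, and the group laws
  -- are pulled back along it. Injectivity is immediate, since `_≋_` is equality of images.
  +-isAbelianGroup : IsAbelianGroup _≋_ _+ₚ_ [] -ₚ_
  +-isAbelianGroup = GroupMonomorphism.isAbelianGroup coeff-isGroupMonomorphism
    (Pointwise.isAbelianGroup ℕ R.+-isAbelianGroup)
    where
    coeff-isGroupMonomorphism : IsGroupMonomorphism
      (RawRing.+-rawGroup ≋-rawRing)
      (AbelianGroup.rawGroup (Pointwise.abelianGroup ℕ R.+-abelianGroup)) coeff
    coeff-isGroupMonomorphism = record
      { isGroupHomomorphism = record
        { isMonoidHomomorphism = record
          { isMagmaHomomorphism = record
            { isRelHomomorphism = record { cong = coeff-≈ }
            ; homo = coeff-+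
            }
          ; ε-homo = λ _ → R.refl
          }
        ; ⁻¹-homo = coeff-neg
        }
      ; injective = coefficientwise
      }

  +-abelianGroup : AbelianGroup c ℓ
  +-abelianGroup = record { isAbelianGroup = +-isAbelianGroup }

  open AbelianGroup +-abelianGroup
    using (setoid; refl; sym; trans)
    renaming (∙-cong to +-cong; ∙-congˡ to +-congˡ; ∙-congʳ to +-congʳ;
              identityʳ to +-identityʳ)
  open CommutativeSemigroupProperties (AbelianGroup.commutativeSemigroup +-abelianGroup)
    using (interchange; x∙yz≈y∙xz)
  open ≈-Reasoning setoid

  -- Scaling and shifting of coefficient lists.

  ∷-cong : ∀ {a b p r} → a R.≈ b → p ≋ r → a ∷ p ≋ b ∷ r
  ∷-cong a≈b p≋r .coeff-≈ zero    = a≈b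
  ∷-cong a≈b p≋r .coeff-≈ (suc n) = coeff-≈ p≋r n

  shift-cong : ∀ {p r} → p ≋ r → shift p ≋ shift r
  shift-cong = ∷-cong R.refl

  -- The left side is a list with one zero entry, equal to `[]` only because trailing zeros are
  -- ignored.
  shift-[] : shift [] ≋ []
  shift-[] .coeff-≈ zero    = R.refl
  shift-[] .coeff-≈ (suc n) = R.refl

  shift-+ : ∀ p r → shift (p +ₚ r) ≋ shift p +ₚ shift r
  shift-+ p r = ∷-cong (R.sym (R.+-identityˡ R.0#)) refl

  scale-cong : ∀ {a b p r} → a R.≈ b → p ≋ r → scale a p ≋ scale b r
  scale-cong {a} {b} {p} {r} a≈b p≋r .coeff-≈ n =
    R.trans (coeff-scale a p n)
      (R.trans (R.*-cong a≈b (coeff-≈ p≋r n)) (R.sym (coeff-scale b r n)))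

  scale-+ : ∀ a p r → scale a (p +ₚ r) ≋ scale a p +ₚ scale a r
  scale-+ a []      r       = refl
  scale-+ a (b ∷ p) []      = refl
  scale-+ a (b ∷ p) (d ∷ r) = ∷-cong (R.distribˡ a b d) (scale-+ a p r)

  scale-* : ∀ a b p → scale (a R.* b) p ≋ scale a (scale b p)
  scale-* a b []      = refl
  scale-* a b (d ∷ p) = ∷-cong (R.*-assoc a b d) (scale-* a b p)

  scale-0 : ∀ p → scale R.0# p ≋ []
  scale-0 p .coeff-≈ n = R.trans (coeff-scale R.0# p n) (R.zeroˡ _)

  scale-1 : ∀ p → scale R.1# p ≋ p
  scale-1 p .coeff-≈ n = R.trans (coeff-scale R.1# p n) (R.*-identityˡ _)

  scale-shift : ∀ a p → scale a (shift p) ≋ shift (scale a p)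
  scale-shift a p = ∷-cong (R.zeroʳ a) refl

  -- Multiplication.

  *-congˡ : ∀ p {r s} → r ≋ s → p *ₚ r ≋ p *ₚ s
  *-congˡ []      r≋s = refl
  *-congˡ (a ∷ p) r≋s = +-cong (scale-cong R.refl r≋s) (shift-cong (*-congˡ p r≋s))

  *-zeroʳ : ∀ p → p *ₚ [] ≋ []
  *-zeroʳ []      = refl
  *-zeroʳ (a ∷ p) = trans (shift-cong (*-zeroʳ p)) shift-[]

  -- `_*ₚ_` recurses on its left factor; this is the mirror recursion on the right one, which gives
  -- commutativity by induction. Commutativity of `R` enters in the constant coefficient.
  *-∷ʳ : ∀ p b r → p *ₚ (b ∷ r) ≋ scale b p +ₚ shift (p *ₚ r)
  *-∷ʳ []      b r = sym shift-[]
  *-∷ʳ (a ∷ p) b r = ∷-cong (R.+-congʳ (R.*-comm a b)) (begin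
    scale a r +ₚ (p *ₚ (b ∷ r))                ≈⟨ +-congˡ (*-∷ʳ p b r) ⟩
    scale a r +ₚ (scale b p +ₚ shift (p *ₚ r)) ≈⟨ x∙yz≈y∙xz (scale a r) (scale b p) (shift (p *ₚ r)) ⟩
    scale b p +ₚ ((a ∷ p) *ₚ r)                ∎)

  *-comm : ∀ p r → p *ₚ r ≋ r *ₚ p
  *-comm []      r = sym (*-zeroʳ r)
  *-comm (a ∷ p) r = begin
    scale a r +ₚ shift (p *ₚ r) ≈⟨ +-congˡ (shift-cong (*-comm p r)) ⟩
    scale a r +ₚ shift (r *ₚ p) ≈⟨ *-∷ʳ r a p ⟨
    r *ₚ (a ∷ p)                ∎

  -- Congruence in the right factor is an induction on the left one. Commutativity transfers it to
  -- the left factor, where `p` and `r` may be lists of different lengths.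
  *-cong : ∀ {p r s u} → p ≋ r → s ≋ u → p *ₚ s ≋ r *ₚ u
  *-cong {p} {r} {s} {u} p≋r s≋u = begin
    p *ₚ s ≈⟨ *-congˡ p s≋u ⟩
    p *ₚ u ≈⟨ *-comm p u ⟩
    u *ₚ p ≈⟨ *-congˡ u p≋r ⟩
    u *ₚ r ≈⟨ *-comm u r ⟩
    r *ₚ u ∎

  *-distribˡ-+ : ∀ p r s → p *ₚ (r +ₚ s) ≋ (p *ₚ r) +ₚ (p *ₚ s)
  *-distribˡ-+ []      r s = refl
  *-distribˡ-+ (a ∷ p) r s = begin
    scale a (r +ₚ s) +ₚ shift (p *ₚ (r +ₚ s))
      ≈⟨ +-cong (scale-+ a r s) (shift-cong (*-distribˡ-+ p r s)) ⟩
    (scale a r +ₚ scale a s) +ₚ shift ((p *ₚ r) +ₚ (p *ₚ s))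
      ≈⟨ +-congˡ (shift-+ (p *ₚ r) (p *ₚ s)) ⟩
    (scale a r +ₚ scale a s) +ₚ (shift (p *ₚ r) +ₚ shift (p *ₚ s))
      ≈⟨ interchange (scale a r) (scale a s) (shift (p *ₚ r)) (shift (p *ₚ s)) ⟩
    ((a ∷ p) *ₚ r) +ₚ ((a ∷ p) *ₚ s) ∎

  *-distribʳ-+ : ∀ p r s → (r +ₚ s) *ₚ p ≋ (r *ₚ p) +ₚ (s *ₚ p)
  *-distribʳ-+ = Consequences.comm∧distrˡ⇒distrʳ setoid +-cong *-comm *-distribˡ-+

  scale-*ˡ : ∀ a p r → scale a p *ₚ r ≋ scale a (p *ₚ r)
  scale-*ˡ a []      r = refl
  scale-*ˡ a (b ∷ p) r = begin
    scale (a R.* b) r +ₚ shift (scale a p *ₚ r)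
      ≈⟨ +-cong (scale-* a b r) (shift-cong (scale-*ˡ a p r)) ⟩
    scale a (scale b r) +ₚ shift (scale a (p *ₚ r))
      ≈⟨ +-congˡ (scale-shift a (p *ₚ r)) ⟨
    scale a (scale b r) +ₚ scale a (shift (p *ₚ r))
      ≈⟨ scale-+ a (scale b r) (shift (p *ₚ r)) ⟨
    scale a ((b ∷ p) *ₚ r) ∎

  shift-*ˡ : ∀ p r → shift p *ₚ r ≋ shift (p *ₚ r)
  shift-*ˡ p r = +-congʳ (scale-0 r)

  *-assoc : ∀ p r s → (p *ₚ r) *ₚ s ≋ p *ₚ (r *ₚ s)
  *-assoc []      r s = refl
  *-assoc (a ∷ p) r s = begin
    (scale a r +ₚ shift (p *ₚ r)) *ₚ s
      ≈⟨ *-distribʳ-+ s (scale a r) (shift (p *ₚ r)) ⟩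
    (scale a r *ₚ s) +ₚ (shift (p *ₚ r) *ₚ s)
      ≈⟨ +-cong (scale-*ˡ a r s) (shift-*ˡ (p *ₚ r) s) ⟩
    scale a (r *ₚ s) +ₚ shift ((p *ₚ r) *ₚ s)
      ≈⟨ +-congˡ (shift-cong (*-assoc p r s)) ⟩
    (a ∷ p) *ₚ (r *ₚ s) ∎

  const-* : ∀ a p → const a *ₚ p ≋ scale a p
  const-* a p = trans (+-congˡ shift-[]) (+-identityʳ (scale a p))

  *-identityˡ : ∀ p → const R.1# *ₚ p ≋ p
  *-identityˡ p = trans (const-* R.1# p) (scale-1 p)

  -- The ring structure, for `_≋_` and for `_≈ₚ_`.

  ≋-isCommutativeRing : IsCommutativeRing _≋_ _+ₚ_ _*ₚ_ -ₚ_ [] (const R.1#)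
  ≋-isCommutativeRing = record
    { isRing = record
      { +-isAbelianGroup = +-isAbelianGroup
      ; *-cong           = *-cong
      ; *-assoc          = *-assoc
      ; *-identity       = Consequences.comm∧idˡ⇒id setoid *-comm *-identityˡ
      ; distrib          = *-distribˡ-+ , *-distribʳ-+
      }
    ; *-comm = *-comm
    }

  -- The identity map carries the laws from `_≋_` back to `_≈ₚ_`, so the result is about
  -- `polyRawRing` itself and the construction can be iterated.
  commutativeRing : CommutativeRing c ℓ
  commutativeRing = record
    { isCommutativeRing = RingMonomorphism.isCommutativeRing ≈ₚ⇒≋ ≋-isCommutativeRing }
    where
    ≈ₚ⇒≋ : IsRingMonomorphism polyRawRing ≋-rawRing (λ p → p)
    ≈ₚ⇒≋ = record
      { isRingHomomorphism = record
        { isSemiringHomomorphism = record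
          { isNearSemiringHomomorphism = record
            { +-isMonoidHomomorphism = record
              { isMagmaHomomorphism = record
                { isRelHomomorphism = record { cong = coefficientwise }
                ; homo = λ _ _ → refl
                }
              ; ε-homo = refl
              }
            ; *-homo = λ _ _ → refl
            }
          ; 1#-homo = refl
          }
        ; -‿homo = λ _ → refl
        }
      ; injective = coeff-≈
      }

  -- Substitution is a ring endomorphism.

  module Substitution (s : Poly) where

    -- A zero polynomial may be a nonempty list of zeros. Well-definedness of substitution comes
    -- down to this case once one of two equal lists is exhausted.
    ⟨⟩-≋[] : ∀ p → p ≋ [] → p ⟨ s ⟩ ≋ []
    ⟨⟩-≋[] []      p≋[] = refl
    ⟨⟩-≋[] (a ∷ p) p≋[] = begin
      const a +ₚ (s *ₚ p ⟨ s ⟩)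
        ≈⟨ +-cong (∷-cong (coeff-≈ p≋[] 0) refl)
                  (*-congˡ s (⟨⟩-≋[] p (coefficientwise (λ n → coeff-≈ p≋[] (suc n))))) ⟩
      const R.0# +ₚ (s *ₚ [])
        ≈⟨ +-cong shift-[] (*-zeroʳ s) ⟩
      [] ∎

    ⟨⟩-cong : ∀ p r → p ≋ r → p ⟨ s ⟩ ≋ r ⟨ s ⟩
    ⟨⟩-cong []      r       p≋r = sym (⟨⟩-≋[] r (sym p≋r))
    ⟨⟩-cong (a ∷ p) []      p≋r = ⟨⟩-≋[] (a ∷ p) p≋r
    ⟨⟩-cong (a ∷ p) (b ∷ r) p≋r =
      +-cong (∷-cong (coeff-≈ p≋r 0) refl)
             (*-congˡ s (⟨⟩-cong p r (coefficientwise (λ n → coeff-≈ p≋r (suc n)))))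

    ⟨⟩-+ : ∀ p r → (p +ₚ r) ⟨ s ⟩ ≋ p ⟨ s ⟩ +ₚ r ⟨ s ⟩
    ⟨⟩-+ []      r       = refl
    ⟨⟩-+ (a ∷ p) []      = sym (+-identityʳ _)
    ⟨⟩-+ (a ∷ p) (b ∷ r) = begin
      const (a R.+ b) +ₚ (s *ₚ (p +ₚ r) ⟨ s ⟩)
        ≈⟨ +-congˡ (*-congˡ s (⟨⟩-+ p r)) ⟩
      const (a R.+ b) +ₚ (s *ₚ (p ⟨ s ⟩ +ₚ r ⟨ s ⟩))
        ≈⟨ +-congˡ (*-distribˡ-+ s (p ⟨ s ⟩) (r ⟨ s ⟩)) ⟩
      (const a +ₚ const b) +ₚ ((s *ₚ p ⟨ s ⟩) +ₚ (s *ₚ r ⟨ s ⟩))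
        ≈⟨ interchange (const a) (const b) (s *ₚ p ⟨ s ⟩) (s *ₚ r ⟨ s ⟩) ⟩
      (a ∷ p) ⟨ s ⟩ +ₚ (b ∷ r) ⟨ s ⟩ ∎

    ⟨⟩-scale : ∀ a p → scale a p ⟨ s ⟩ ≋ scale a (p ⟨ s ⟩)
    ⟨⟩-scale a []      = refl
    ⟨⟩-scale a (b ∷ p) = begin
      const (a R.* b) +ₚ (s *ₚ scale a p ⟨ s ⟩)
        ≈⟨ +-congˡ (*-congˡ s (⟨⟩-scale a p)) ⟩
      const (a R.* b) +ₚ (s *ₚ scale a (p ⟨ s ⟩))
        -- `scale-*ˡ` extracts a scalar from the left factor only, hence the commutation before and
        -- after it.
        ≈⟨ +-congˡ (*-comm s _) ⟩
      const (a R.* b) +ₚ (scale a (p ⟨ s ⟩) *ₚ s)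
        ≈⟨ +-congˡ (scale-*ˡ a (p ⟨ s ⟩) s) ⟩
      const (a R.* b) +ₚ scale a (p ⟨ s ⟩ *ₚ s)
        ≈⟨ +-congˡ (scale-cong R.refl (*-comm (p ⟨ s ⟩) s)) ⟩
      scale a (const b) +ₚ scale a (s *ₚ p ⟨ s ⟩)
        ≈⟨ scale-+ a (const b) (s *ₚ p ⟨ s ⟩) ⟨
      scale a ((b ∷ p) ⟨ s ⟩) ∎

    ⟨⟩-* : ∀ p r → (p *ₚ r) ⟨ s ⟩ ≋ p ⟨ s ⟩ *ₚ r ⟨ s ⟩
    ⟨⟩-* []      r = refl
    ⟨⟩-* (a ∷ p) r = begin
      (scale a r +ₚ shift (p *ₚ r)) ⟨ s ⟩
        ≈⟨ ⟨⟩-+ (scale a r) (shift (p *ₚ r)) ⟩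
      scale a r ⟨ s ⟩ +ₚ (const R.0# +ₚ (s *ₚ (p *ₚ r) ⟨ s ⟩))
        ≈⟨ +-cong (⟨⟩-scale a r) (+-congʳ shift-[]) ⟩
      scale a (r ⟨ s ⟩) +ₚ (s *ₚ (p *ₚ r) ⟨ s ⟩)
        ≈⟨ +-cong (sym (const-* a (r ⟨ s ⟩))) (*-congˡ s (⟨⟩-* p r)) ⟩
      (const a *ₚ r ⟨ s ⟩) +ₚ (s *ₚ (p ⟨ s ⟩ *ₚ r ⟨ s ⟩))
        ≈⟨ +-congˡ (*-assoc s (p ⟨ s ⟩) (r ⟨ s ⟩)) ⟨
      (const a *ₚ r ⟨ s ⟩) +ₚ ((s *ₚ p ⟨ s ⟩) *ₚ r ⟨ s ⟩)
        ≈⟨ *-distribʳ-+ (r ⟨ s ⟩) (const a) (s *ₚ p ⟨ s ⟩) ⟨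
      (a ∷ p) ⟨ s ⟩ *ₚ r ⟨ s ⟩ ∎

    -- Sums and zero are preserved, so uniqueness of additive inverses suffices.
    ⟨⟩-neg : ∀ p → (-ₚ p) ⟨ s ⟩ ≋ -ₚ (p ⟨ s ⟩)
    ⟨⟩-neg p = GroupProperties.inverseˡ-unique (AbelianGroup.group +-abelianGroup) _ _ (begin
      (-ₚ p) ⟨ s ⟩ +ₚ p ⟨ s ⟩ ≈⟨ ⟨⟩-+ (-ₚ p) p ⟨
      ((-ₚ p) +ₚ p) ⟨ s ⟩     ≈⟨ ⟨⟩-≋[] _ (AbelianGroup.inverseˡ +-abelianGroup p) ⟩
      []                      ∎)

    -- For ℤ[q] as coefficient ring this says that the substitution for t fixes q.
    ⟨⟩-const : ∀ a → const a ⟨ s ⟩ ≋ const a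
    ⟨⟩-const a = +-congˡ {const a} (*-zeroʳ s)

    ⟨⟩-X : X ⟨ s ⟩ ≋ s
    ⟨⟩-X = begin
      const R.0# +ₚ (s *ₚ const R.1# ⟨ s ⟩) ≈⟨ +-cong shift-[] (*-congˡ s (⟨⟩-const R.1#)) ⟩
      s *ₚ const R.1#                       ≈⟨ *-comm s (const R.1#) ⟩
      const R.1# *ₚ s                       ≈⟨ *-identityˡ s ⟩
      s                                     ∎

    ⟨⟩-isRingHomomorphism : IsRingHomomorphism polyRawRing polyRawRing (_⟨ s ⟩)
    ⟨⟩-isRingHomomorphism = record
      { isSemiringHomomorphism = record
        { isNearSemiringHomomorphism = record
          { +-isMonoidHomomorphism = record
            { isMagmaHomomorphism = record
              { isRelHomomorphism = record
                { cong = λ {p} {r} p≈r → coeff-≈ (⟨⟩-cong p r (coefficientwise p≈r)) }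
              ; homo = λ p r → coeff-≈ (⟨⟩-+ p r)
              }
            ; ε-homo = λ _ → R.refl
            }
          ; *-homo = λ p r → coeff-≈ (⟨⟩-* p r)
          }
        ; 1#-homo = coeff-≈ (⟨⟩-const R.1#)
        }
      ; -‿homo = λ p → coeff-≈ (⟨⟩-neg p)
      }

-- The functional equation over an abstract commutative ring.

module FunctionalEquation {κ ℓ} (R : CommutativeRing κ ℓ) where

  open CommutativeRing R
  open Exp semiring using (_^_; ^-homo-*; ^-congʳ; ^-congˡ)
  open RingProperties ring using (-‿distribˡ-*; -‿distribʳ-*)
  open GroupProperties +-group using () renaming (⁻¹-involutive to -‿involutive)
  open ≈-Reasoning setoid
  open SemiringSolver commutativeSemiring using (solve; con; _:+_; _:*_; _:^_; _:=_)

  -- `T`, `S` and the substitution `φ` enter only through these hypotheses, so they stay opaque and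
  -- no coefficient list is unfolded.
  module _
    (φ : Carrier → Carrier) (φ-isRingHomomorphism : IsRingHomomorphism rawRing rawRing φ)
    (t q : Carrier) (φ-t : φ t ≈ t * q) (φ-q : φ q ≈ q)
    (T : ℕ → Carrier) (S : ℕ → ℕ → Carrier)
    (T-zero : T 0 ≈ 1#)
    (T-suc : ∀ n → T (suc n) ≈
      T n + (1# + t) * (- q) ^ (suc n ℕ.^ 2) + (1# - t ^ 2) * S (suc n) n)
    (S-zero : ∀ k → S k 0 ≈ 0#)
    (S-suc : ∀ k m → S k (suc m) ≈ S k m + (- q) ^ (k ℕ.^ 2 ∸ suc m ℕ.^ 2) * T m)
    where

    open IsRingHomomorphism φ-isRingHomomorphism
      renaming (⟦⟧-cong to φ-cong; +-homo to φ-+; *-homo to φ-*; -‿homo to φ-neg; 1#-homo to φ-1)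

    -- With Q, u and - t as atoms no subtraction is left, so the identities below are within
    -- reach of the semiring solver; only the case k = 1 also needs - t + t ≈ 0.
    Q : Carrier
    Q = - q

    u : Carrier
    u = - (t ^ 2)

    -- The three-term recurrence for `T`.

    c : ℕ → Carrier
    c n = Q ^ (2 ℕ.* n ℕ.+ 1)

    c-suc : ∀ n → c (suc n) ≈ Q ^ 2 * c n
    c-suc n = trans (^-congʳ Q (exponent n)) (^-homo-* Q 2 (2 ℕ.* n ℕ.+ 1))
      where
      exponent : ∀ n → 2 ℕ.* suc n ℕ.+ 1 ≡.≡ 2 ℕ.+ (2 ℕ.* n ℕ.+ 1)
      exponent = solve-∀

    -- The exponent of `c n` is the gap between consecutive squares.
    square-suc : ∀ n → suc n ℕ.^ 2 ≡.≡ (2 ℕ.* n ℕ.+ 1) ℕ.+ n ℕ.^ 2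
    square-suc = expand
      where
      -- The powers are written as the products to which they compute, for the solver.
      expand : ∀ n → (1 ℕ.+ n) ℕ.* ((1 ℕ.+ n) ℕ.* 1) ≡.≡ (2 ℕ.* n ℕ.+ 1) ℕ.+ n ℕ.* (n ℕ.* 1)
      expand = solve-∀

    Q^square-suc : ∀ n → Q ^ (suc n ℕ.^ 2) ≈ c n * Q ^ (n ℕ.^ 2)
    Q^square-suc n = trans (^-congʳ Q (square-suc n)) (^-homo-* Q (2 ℕ.* n ℕ.+ 1) (n ℕ.^ 2))

    -- Each exponent (k+1)^2 - i^2 is (2k+1) + (k^2 - i^2), so all summands gain the same factor.
    -- The bound `m ≤ k` keeps k^2 - i^2 free of truncation.
    S-shift : ∀ k m → m ≤ k → S (suc k) m ≈ c k * S k m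
    S-shift k zero    m≤k = begin
      S (suc k) 0 ≈⟨ S-zero (suc k) ⟩
      0#          ≈⟨ zeroʳ (c k) ⟨
      c k * 0#    ≈⟨ *-congˡ (S-zero k) ⟨
      c k * S k 0 ∎
    S-shift k (suc m) m<k = begin
      S (suc k) (suc m)
        ≈⟨ S-suc (suc k) m ⟩
      S (suc k) m + Q ^ (suc k ℕ.^ 2 ∸ suc m ℕ.^ 2) * T m
        ≈⟨ +-cong (S-shift k m (ℕ.<⇒≤ m<k)) (*-congʳ power) ⟩
      c k * S k m + (c k * Q ^ e) * T m
        ≈⟨ solve 4 (λ x s y a → x :* s :+ (x :* y) :* a := x :* (s :+ y :* a)) refl
                 (c k) (S k m) (Q ^ e) (T m) ⟩
      c k * (S k m + Q ^ e * T m)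
        ≈⟨ *-congˡ (S-suc k m) ⟨
      c k * S k (suc m) ∎
      where
      e : ℕ
      e = k ℕ.^ 2 ∸ suc m ℕ.^ 2

      exponent : suc k ℕ.^ 2 ∸ suc m ℕ.^ 2 ≡.≡ (2 ℕ.* k ℕ.+ 1) ℕ.+ e
      exponent = ≡.trans (≡.cong (_∸ suc m ℕ.^ 2) (square-suc k))
        (ℕ.+-∸-assoc (2 ℕ.* k ℕ.+ 1) (ℕ.^-monoˡ-≤ 2 m<k))

      power : Q ^ (suc k ℕ.^ 2 ∸ suc m ℕ.^ 2) ≈ c k * Q ^ e
      power = trans (^-congʳ Q exponent) (^-homo-* Q (2 ℕ.* k ℕ.+ 1) e)

    T-one : T 1 ≈ 1# + Q + t * Q
    T-one = begin
      T 1
        ≈⟨ T-suc 0 ⟩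
      -- `1# - t ^ 2` is `1# + u` by definition.
      T 0 + (1# + t) * Q ^ 1 + (1# + u) * S 1 0
        ≈⟨ +-cong (+-congʳ T-zero) (*-congˡ (S-zero 1)) ⟩
      1# + (1# + t) * Q ^ 1 + (1# + u) * 0#
        ≈⟨ solve 3 (λ t Q u →
             con 1 :+ (con 1 :+ t) :* Q :^ 1 :+ (con 1 :+ u) :* con 0
             := con 1 :+ Q :+ t :* Q) refl t Q u ⟩
      1# + Q + t * Q ∎

    -- The power of `Q` and the sum in T_{n+2} are c_{n+1} times those in T_{n+1}, up to the new top
    -- summand i = n+1, which is c_{n+1} T_n.
    T-recurrence : ∀ n →
      T (2 ℕ.+ n) ≈ T (1 ℕ.+ n) + c (1 ℕ.+ n) * T (1 ℕ.+ n) + u * c (1 ℕ.+ n) * T n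
    T-recurrence n = begin
      T (2 ℕ.+ n)
        ≈⟨ T-suc k ⟩
      T k + (1# + t) * Q ^ (suc k ℕ.^ 2) + (1# + u) * S (suc k) k
        ≈⟨ +-cong (+-congˡ (*-congˡ (Q^square-suc k))) (*-congˡ sum) ⟩
      T k + (1# + t) * (c k * p) + (1# + u) * (c k * s + c k * T n)
        -- In the last product, the 1 of `1# + u` completes the bracket to the defining expression
        -- of `T k`; its `u` leaves the final term.
        ≈⟨ solve 7 (λ b a t x p u s →
             b :+ (con 1 :+ t) :* (x :* p) :+ (con 1 :+ u) :* (x :* s :+ x :* a)
             := b :+ x :* (a :+ (con 1 :+ t) :* p :+ (con 1 :+ u) :* s) :+ u :* x :* a)
             refl (T k) (T n) t (c k) p u s ⟩
      T k + c k * (T n + (1# + t) * p + (1# + u) * s) + u * c k * T n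
        ≈⟨ +-congʳ (+-congˡ (*-congˡ (T-suc n))) ⟨
      T k + c k * T k + u * c k * T n ∎
      where
      k : ℕ
      k = suc n

      p s : Carrier
      p = Q ^ (k ℕ.^ 2)
      s = S k n

      sum : S (suc k) k ≈ c k * s + c k * T n
      sum = begin
        S (suc k) k
          ≈⟨ S-suc (suc k) n ⟩
        S (suc k) n + Q ^ (suc k ℕ.^ 2 ∸ k ℕ.^ 2) * T n
          ≈⟨ +-cong (S-shift k n (ℕ.n≤1+n n)) (*-congʳ (^-congʳ Q exponent)) ⟩
        c k * s + c k * T n ∎
        where
        exponent : suc k ℕ.^ 2 ∸ k ℕ.^ 2 ≡.≡ 2 ℕ.* k ℕ.+ 1
        exponent = ≡.trans (≡.cong (_∸ k ℕ.^ 2) (square-suc k))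
          (ℕ.m+n∸n≡m (2 ℕ.* k ℕ.+ 1) (k ℕ.^ 2))

    -- The recurrence after substitution.

    φ-^ : ∀ x n → φ (x ^ n) ≈ φ x ^ n
    φ-^ x zero    = φ-1
    φ-^ x (suc n) = trans (φ-* x (x ^ n)) (*-congˡ (φ-^ x n))

    φ-Q : φ Q ≈ Q
    φ-Q = trans (φ-neg q) (-‿cong φ-q)

    φ-c : ∀ n → φ (c n) ≈ c n
    φ-c n = trans (φ-^ Q (2 ℕ.* n ℕ.+ 1)) (^-congˡ (2 ℕ.* n ℕ.+ 1) φ-Q)

    Q*Q≈q*q : Q * Q ≈ q * q
    Q*Q≈q*q = begin
      - q * - q     ≈⟨ -‿distribˡ-* q (- q) ⟨
      - (q * - q)   ≈⟨ -‿cong (-‿distribʳ-* q q) ⟨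
      - - (q * q)   ≈⟨ -‿involutive (q * q) ⟩
      q * q         ∎

    φ-u : φ u ≈ u * Q ^ 2
    φ-u = begin
      φ (- (t ^ 2))
        ≈⟨ φ-neg (t ^ 2) ⟩
      - φ (t ^ 2)
        ≈⟨ -‿cong (trans (φ-^ t 2) (^-congˡ 2 φ-t)) ⟩
      - (t * q) ^ 2
        ≈⟨ -‿cong (solve 2 (λ t q → (t :* q) :^ 2 := t :^ 2 :* (q :* q)) refl t q) ⟩
      - (t ^ 2 * (q * q))
        ≈⟨ -‿distribˡ-* (t ^ 2) (q * q) ⟩
      u * (q * q)
        ≈⟨ *-congˡ Q*Q≈q*q ⟨
      u * (Q * Q)
        ≈⟨ *-congˡ (*-congˡ (*-identityʳ Q)) ⟨
      u * Q ^ 2 ∎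

    φT-recurrence : ∀ n → φ (T (2 ℕ.+ n)) ≈
      φ (T (1 ℕ.+ n)) + c (1 ℕ.+ n) * φ (T (1 ℕ.+ n)) + u * Q ^ 2 * c (1 ℕ.+ n) * φ (T n)
    φT-recurrence n = begin
      φ (T (suc k))
        ≈⟨ φ-cong (T-recurrence n) ⟩
      φ (T k + c k * T k + u * c k * T n)
        ≈⟨ trans (φ-+ _ _) (+-congʳ (φ-+ _ _)) ⟩
      φ (T k) + φ (c k * T k) + φ (u * c k * T n)
        ≈⟨ +-cong (+-congˡ (φ-* _ _)) (trans (φ-* _ _) (*-congʳ (φ-* _ _))) ⟩
      φ (T k) + φ (c k) * φ (T k) + φ u * φ (c k) * φ (T n)
        ≈⟨ +-cong (+-congˡ (*-congʳ (φ-c k))) (*-congʳ (*-cong φ-u (φ-c k))) ⟩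
      φ (T k) + c k * φ (T k) + u * Q ^ 2 * c k * φ (T n) ∎
      where
      k : ℕ
      k = suc n

    -- The image tq of t is rewritten as (-t)Q, so that only the atoms `- t` and `Q` remain.
    φT-one : φ (T 1) ≈ 1# + Q + - t * Q ^ 2
    φT-one = begin
      φ (T 1)
        ≈⟨ φ-cong T-one ⟩
      φ (1# + Q + t * Q)
        ≈⟨ trans (φ-+ _ _) (+-cong (φ-+ _ _) (φ-* _ _)) ⟩
      φ 1# + φ Q + φ t * φ Q
        ≈⟨ +-cong (+-cong φ-1 φ-Q) (*-cong φ-t φ-Q) ⟩
      1# + Q + t * q * Q
        ≈⟨ +-congˡ (*-congʳ t*q≈-t*Q) ⟩
      1# + Q + - t * Q * Q
        ≈⟨ +-congˡ (solve 2 (λ x Q → x :* Q :* Q := x :* Q :^ 2) refl (- t) Q) ⟩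
      1# + Q + - t * Q ^ 2 ∎
      where
      t*q≈-t*Q : t * q ≈ - t * Q
      t*q≈-t*Q = begin
        t * q         ≈⟨ -‿involutive (t * q) ⟨
        - - (t * q)   ≈⟨ -‿cong (-‿distribʳ-* t q) ⟩
        - (t * - q)   ≈⟨ -‿distribˡ-* t (- q) ⟩
        - t * Q       ∎

    -- The functional equation in terms of `Q` and `u`, with `G` for 1 - tq.

    G : Carrier
    G = 1# + t * Q

    functionalEquation-one : G * φ (T 1) ≈ T 1 + u * c 1 * T 0
    functionalEquation-one = begin
      G * φ (T 1)
        ≈⟨ *-congˡ φT-one ⟩
      G * (1# + Q + - t * Q ^ 2)
        -- The atom `x` is `- t`, which the solver cannot relate to `t`. The cross terms are
        -- therefore collected last and cancelled in the next step, where also x t becomes u;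
        -- `con 1` stands for `T 0`.
        ≈⟨ solve 3 (λ t Q x →
             (con 1 :+ t :* Q) :* (con 1 :+ Q :+ x :* Q :^ 2)
             := con 1 :+ Q :+ t :* Q :+ x :* t :* Q :^ 3 :* con 1 :+ (x :+ t) :* Q :^ 2)
             refl t Q (- t) ⟩
      1# + Q + t * Q + - t * t * c 1 * 1# + (- t + t) * Q ^ 2
        ≈⟨ +-cong (+-congˡ (*-congʳ (*-congʳ -t*t≈u))) (trans (*-congʳ (-‿inverseˡ t)) (zeroˡ _)) ⟩
      1# + Q + t * Q + u * c 1 * 1# + 0#
        ≈⟨ +-identityʳ _ ⟩
      1# + Q + t * Q + u * c 1 * 1#
        ≈⟨ +-cong T-one (*-congˡ T-zero) ⟨
      T 1 + u * c 1 * T 0 ∎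
      where
      -t*t≈u : - t * t ≈ u
      -t*t≈u = trans (sym (-‿distribˡ-* t t)) (-‿cong (*-congˡ (sym (*-identityʳ t))))

    functionalEquation-two : G * φ (T 2) ≈ T 2 + u * c 2 * T 1
    functionalEquation-two = begin
      G * φ (T 2)
        ≈⟨ *-congˡ (φT-recurrence 0) ⟩
      G * (φ (T 1) + c 1 * φ (T 1) + u * Q ^ 2 * c 1 * φ (T 0))
        ≈⟨ *-congˡ (+-congˡ (*-congˡ (trans (φ-cong T-zero) φ-1))) ⟩
      G * (φ (T 1) + c 1 * φ (T 1) + u * Q ^ 2 * c 1 * 1#)
        ≈⟨ solve 5 (λ g f x u y →
             g :* (f :+ x :* f :+ u :* y :* x :* con 1)
             := (con 1 :+ x) :* (g :* f) :+ u :* y :* x :* g) refl G (φ (T 1)) (c 1) u (Q ^ 2) ⟩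
      (1# + c 1) * (G * φ (T 1)) + u * Q ^ 2 * c 1 * G
        ≈⟨ +-congʳ (*-congˡ (trans functionalEquation-one (+-congˡ (*-congˡ T-zero)))) ⟩
      (1# + c 1) * (T 1 + u * c 1 * 1#) + u * Q ^ 2 * c 1 * G
        -- With c_1 = Q^3 and c_2 = Q^5 explicit, the terms u Q^5, u Q^6 and u t Q^6 combine to u
        -- c_2 (1 + Q + tQ), which is u c_2 T_1.
        ≈⟨ solve 4 (λ t Q u a →
             (con 1 :+ Q :^ 3) :* (a :+ u :* Q :^ 3 :* con 1)
               :+ u :* Q :^ 2 :* Q :^ 3 :* (con 1 :+ t :* Q)
             := (a :+ Q :^ 3 :* a :+ u :* Q :^ 3 :* con 1)
               :+ u :* Q :^ 5 :* (con 1 :+ Q :+ t :* Q)) refl t Q u (T 1) ⟩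
      (T 1 + c 1 * T 1 + u * c 1 * 1#) + u * c 2 * (1# + Q + t * Q)
        ≈⟨ +-cong (trans (T-recurrence 0) (+-congˡ (*-congˡ T-zero))) (*-congˡ T-one) ⟨
      T 2 + u * c 2 * T 1 ∎

    -- Induction reaching two steps back: the recurrence for φ(T_k) is multiplied by `G`, and the
    -- two earlier equations are inserted.
    functionalEquation-signless : ∀ n → G * φ (T (1 ℕ.+ n)) ≈ T (1 ℕ.+ n) + u * c (1 ℕ.+ n) * T n
    functionalEquation-signless zero          = functionalEquation-one
    functionalEquation-signless (suc zero)    = functionalEquation-two
    functionalEquation-signless (suc (suc n)) = begin
      G * φ (T (3 ℕ.+ n))
        ≈⟨ *-congˡ (φT-recurrence (suc n)) ⟩
      G * (φ T₂ + c (2 ℕ.+ n) * φ T₂ + u * Q ^ 2 * c (2 ℕ.+ n) * φ T₁)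
        ≈⟨ solve 6 (λ g f₂ f₁ x u y →
             g :* (f₂ :+ x :* f₂ :+ u :* y :* x :* f₁)
             := (con 1 :+ x) :* (g :* f₂) :+ u :* y :* x :* (g :* f₁))
             refl G (φ T₂) (φ T₁) (c (2 ℕ.+ n)) u (Q ^ 2) ⟩
      (1# + c (2 ℕ.+ n)) * (G * φ T₂) + u * Q ^ 2 * c (2 ℕ.+ n) * (G * φ T₁)
        ≈⟨ +-cong (*-congˡ (functionalEquation-signless (suc n))) (*-congˡ (functionalEquation-signless n)) ⟩
      (1# + c (2 ℕ.+ n)) * (T₂ + u * c (2 ℕ.+ n) * T₁)
        + u * Q ^ 2 * c (2 ℕ.+ n) * (T₁ + u * d * T₀)
        ≈⟨ +-cong (*-congʳ (+-congˡ c₂)) (*-congʳ (*-congˡ c₂)) ⟩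
      (1# + Q ^ 2 * d) * (T₂ + u * c (2 ℕ.+ n) * T₁)
        + u * Q ^ 2 * (Q ^ 2 * d) * (T₁ + u * d * T₀)
        ≈⟨ +-congʳ (*-congˡ (+-congˡ (*-congʳ (*-congˡ c₂)))) ⟩
      (1# + Q ^ 2 * d) * (T₂ + u * (Q ^ 2 * d) * T₁)
        + u * Q ^ 2 * (Q ^ 2 * d) * (T₁ + u * d * T₀)
        -- Here y d = c_{n+2} and y y d = c_{n+3}. The terms beyond the first bracket share the
        -- factor u c_{n+3}; what remains of them is the recurrence for T_{n+2}, while the first
        -- bracket is the one for T_{n+3}.
        ≈⟨ solve 6 (λ y d u T₀ T₁ T₂ →
             (con 1 :+ y :* d) :* (T₂ :+ u :* (y :* d) :* T₁)
               :+ u :* y :* (y :* d) :* (T₁ :+ u :* d :* T₀)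
             := (T₂ :+ y :* d :* T₂ :+ u :* (y :* d) :* T₁)
               :+ u :* (y :* (y :* d)) :* (T₁ :+ d :* T₁ :+ u :* d :* T₀))
             refl (Q ^ 2) d u T₀ T₁ T₂ ⟩
      (T₂ + Q ^ 2 * d * T₂ + u * (Q ^ 2 * d) * T₁)
        + u * (Q ^ 2 * (Q ^ 2 * d)) * (T₁ + d * T₁ + u * d * T₀)
        ≈⟨ +-cong (+-cong (+-congˡ (*-congʳ c₂)) (*-congʳ (*-congˡ c₂)))
                  (*-cong (*-congˡ c₃) (T-recurrence n)) ⟨
      (T₂ + c (2 ℕ.+ n) * T₂ + u * c (2 ℕ.+ n) * T₁) + u * c (3 ℕ.+ n) * T₂
        ≈⟨ +-congʳ (T-recurrence (suc n)) ⟨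
      T (3 ℕ.+ n) + u * c (3 ℕ.+ n) * T (2 ℕ.+ n) ∎
      where
      T₀ T₁ T₂ d : Carrier
      T₀ = T n
      T₁ = T (1 ℕ.+ n)
      T₂ = T (2 ℕ.+ n)
      d  = c (1 ℕ.+ n)

      c₂ : c (2 ℕ.+ n) ≈ Q ^ 2 * d
      c₂ = c-suc (1 ℕ.+ n)

      c₃ : c (3 ℕ.+ n) ≈ Q ^ 2 * (Q ^ 2 * d)
      c₃ = trans (c-suc (2 ℕ.+ n)) (*-congˡ c₂)

    -- Return from `Q` and `u` to q and t.

    c≈-q^ : ∀ n → c n ≈ - (q ^ (2 ℕ.* n ℕ.+ 1))
    c≈-q^ zero    = sym (-‿distribˡ-* q 1#)
    c≈-q^ (suc n) = begin
      c (suc n)                              ≈⟨ c-suc n ⟩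
      -- The exponent grows by two and Q^2 = q^2, so the sign stays that of the case n = 0.
      Q ^ 2 * c n                            ≈⟨ *-cong Q²≈q² (c≈-q^ n) ⟩
      q ^ 2 * - (q ^ (2 ℕ.* n ℕ.+ 1))        ≈⟨ -‿distribʳ-* _ _ ⟨
      - (q ^ 2 * q ^ (2 ℕ.* n ℕ.+ 1))        ≈⟨ -‿cong (^-homo-* q 2 (2 ℕ.* n ℕ.+ 1)) ⟨
      - (q ^ (2 ℕ.+ (2 ℕ.* n ℕ.+ 1)))        ≈⟨ -‿cong (^-congʳ q (exponent n)) ⟩
      - (q ^ (2 ℕ.* suc n ℕ.+ 1))            ∎
      where
      Q²≈q² : Q ^ 2 ≈ q ^ 2
      Q²≈q² = trans (*-congˡ (*-identityʳ Q)) (trans Q*Q≈q*q (*-congˡ (sym (*-identityʳ q))))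

      exponent : ∀ n → 2 ℕ.+ (2 ℕ.* n ℕ.+ 1) ≡.≡ 2 ℕ.* suc n ℕ.+ 1
      exponent = solve-∀

    -- Both `u` and c_k carry a minus sign, and the two cancel in u c_k = t^2 q^(2k+1).
    functionalEquation : ∀ n → (1# - t * q) * φ (T (1 ℕ.+ n)) ≈
      T (1 ℕ.+ n) + t ^ 2 * q ^ (2 ℕ.* suc n ℕ.+ 1) * T n
    functionalEquation n = begin
      (1# - t * q) * φ (T (1 ℕ.+ n))
        ≈⟨ *-congʳ (+-congˡ (-‿distribʳ-* t q)) ⟩
      G * φ (T (1 ℕ.+ n))
        ≈⟨ functionalEquation-signless n ⟩
      T (1 ℕ.+ n) + u * c (suc n) * T n
        ≈⟨ +-congˡ (*-congʳ (*-congˡ (c≈-q^ (suc n)))) ⟩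
      T (1 ℕ.+ n) + - (t ^ 2) * - r * T n
        ≈⟨ +-congˡ (*-congʳ sign) ⟩
      T (1 ℕ.+ n) + t ^ 2 * r * T n ∎
      where
      r : Carrier
      r = q ^ (2 ℕ.* suc n ℕ.+ 1)

      sign : - (t ^ 2) * - r ≈ t ^ 2 * r
      sign = begin
        - (t ^ 2) * - r   ≈⟨ -‿distribˡ-* _ _ ⟨
        - (t ^ 2 * - r)   ≈⟨ -‿cong (-‿distribʳ-* _ _) ⟨
        - - (t ^ 2 * r)   ≈⟨ -‿involutive _ ⟩
        t ^ 2 * r         ∎

-- Specialisation to ℤ[t,q].

open import Defs

module ℤ[q]-Ring = PolynomialRing +-*-commutativeRing
module ℤ[t,q]-Ring = PolynomialRing ℤ[q]-Ring.commutativeRing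
open ℤ[t,q]-Ring.Substitution (t * q) using (⟨⟩-isRingHomomorphism; ⟨⟩-X; ⟨⟩-const)
open ℤ[t,q]-Ring using (module _≋_)

corollary4p2 : ∀ (k : ℕ) → k ≥ 1 →
    (1# - t * q) * (T k [t:= t * q ]) ≈ T k + t ^ 2 * q ^ (2 ℕ.* k ℕ.+ 1) * T (k ∸ 1)
corollary4p2 (suc n) _ = FunctionalEquation.functionalEquation ℤ[t,q]-Ring.commutativeRing
  (_[t:= t * q ]) ⟨⟩-isRingHomomorphism t q
  (_≋_.coeff-≈ ⟨⟩-X) (_≋_.coeff-≈ (⟨⟩-const (Polynomial.X +-*-rawRing)))
  -- The defining equations hold by computation. The last two arguments of each function are the
  -- indices of a coefficient, in t and then in q.
  T S (λ _ _ → ≡.refl) (λ _ _ _ → ≡.refl) (λ _ _ _ → ≡.refl) (λ _ _ _ _ → ≡.refl) n
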